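{- Let $\lambda$ be a partition whose Young diagram contains that of $(3,3,1)$ or that of $(2,2,2,2)$. Then there exist finite naturally labeled posets $P$ and $Q$ with $P\not\cong Q$, $\operatorname{sh}(P)=\operatorname{sh}(Q)=\lambda$, and $K_P(\mathbf{x})=K_Q(\mathbf{x})$.
   Context: A poset $(P,\preceq)$ on ground set $[n]=\{1,\dots,n\}$ is naturally labeled if $x\preceq y$ implies $x\le y$ as integers. For such $P$, the $P$-partition generating function is $K_P(\mathbf{x})=\sum_{\sigma}\prod_{p\in P}x_{\sigma(p)}$, the sum over all maps $\sigma:P\to\mathbb{Z}^+$ with $\sigma(x)\le\sigma(y)$ whenever $x\preceq y$. The shape $\operatorname{sh}(P)$ is the partition $\lambda$ whose conjugate $\lambda'$ satisfies $\lambda'_1+\cdots+\lambda'_i=a_i$ for all $i$, where $a_i$ is the maximum number of elements in a union of $i$ antichains of $P$. -}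

module Defs where

open import Data.Nat using (ℕ; zero; suc; _+_; _≤_; _<_; _≤?_)
import Data.Nat as ℕ
open import Data.Fin using (Fin; toℕ; _≟_)
import Data.Fin as F
open import Data.Fin.Properties using (all?)
open import Data.Fin.Subset using (Subset; _∈_; ⋃; ∣_∣)
open import Data.List using (List; []; _∷_; length; filter; concatMap; map; allFin)
open import Data.List.Relation.Unary.All using (All)
open import Data.List.Relation.Unary.Linked using (Linked)
open import Data.Vec using (Vec; []; _∷_; lookup; count; toList)
open import Data.Product using (Σ; _×_; _,_; ∃)
open import Relation.Binary.PropositionalEquality using (_≡_)
open import Relation.Nullary using (Dec; ¬_)
open import Relation.Nullary.Decidable using (_×-dec_; _→-dec_)

IsPartition : List ℕ → Set
IsPartition la = Linked (λ a b → b ≤ a) la × All (0 <_) la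

part : List ℕ → ℕ → ℕ
part []       i       = 0
part (x ∷ xs) zero    = x
part (x ∷ xs) (suc i) = part xs i

_⊇ʸ_ : List ℕ → List ℕ → Set
la ⊇ʸ mu = ∀ i → part mu i ≤ part la i

-- j-th part of the conjugate partition (j ≥ 1): #{ parts ≥ j }.
conjPart : List ℕ → ℕ → ℕ
conjPart la j = length (filter (j ≤?_) la)

conjSum : List ℕ → ℕ → ℕ
conjSum la zero    = 0
conjSum la (suc i) = conjSum la i + conjPart la (suc i)

record NLPoset (n : ℕ) : Set₁ where
  field
    _≼_     : Fin n → Fin n → Set
    _≼?_    : ∀ x y → Dec (x ≼ y)
    refl    : ∀ x → x ≼ x
    antisym : ∀ x y → x ≼ y → y ≼ x → x ≡ y
    trans   : ∀ x y z → x ≼ y → y ≼ z → x ≼ z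
    natural : ∀ x y → x ≼ y → toℕ x ≤ toℕ y

open NLPoset

Iso : ∀ {n m} → NLPoset n → NLPoset m → Set
Iso {n} {m} P Q =
  Σ (Fin n → Fin m) λ f → Σ (Fin m → Fin n) λ g →
    (∀ x → g (f x) ≡ x) × (∀ y → f (g y) ≡ y) ×
    (∀ x y → (_≼_ P x y → _≼_ Q (f x) (f y)) × (_≼_ Q (f x) (f y) → _≼_ P x y))

IsAntichain : ∀ {n} → NLPoset n → Subset n → Set
IsAntichain P S = ∀ x y → x ∈ S → y ∈ S → _≼_ P x y → x ≡ y

MaxUnionAntichains : ∀ {n} → NLPoset n → ℕ → ℕ → Set
MaxUnionAntichains {n} P i a =
  (Σ (Vec (Subset n) i) λ As →
      (∀ j → IsAntichain P (lookup As j)) × ∣ ⋃ (toList As) ∣ ≡ a)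
  × (∀ (As : Vec (Subset n) i) →
      (∀ j → IsAntichain P (lookup As j)) → ∣ ⋃ (toList As) ∣ ≤ a)

HasShape : ∀ {n} → NLPoset n → List ℕ → Set
HasShape P la = ∀ i → MaxUnionAntichains P i (conjSum la i)

-- P-partition generating function, via its coefficients.
-- A map sigma : [n] → {1..k} is represented by a vector in Vec (Fin k) n.

allVecs : (n k : ℕ) → List (Vec (Fin k) n)
allVecs zero    k = [] ∷ []
allVecs (suc n) k = concatMap (λ i → map (i ∷_) (allVecs n k)) (allFin k)

IsPPartition : ∀ {n k} → NLPoset n → Vec (Fin k) n → Set
IsPPartition P σ = ∀ x y → _≼_ P x y → lookup σ x F.≤ lookup σ y

HasContent : ∀ {n k} → (Fin k → ℕ) → Vec (Fin k) n → Set
HasContent α σ = ∀ j → count (_≟ j) σ ≡ α j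

isPPartition? : ∀ {n k} (P : NLPoset n) (σ : Vec (Fin k) n) → Dec (IsPPartition P σ)
isPPartition? P σ = all? λ x → all? λ y → _≼?_ P x y →-dec (lookup σ x F.≤? lookup σ y)

hasContent? : ∀ {n k} (α : Fin k → ℕ) (σ : Vec (Fin k) n) → Dec (HasContent α σ)
hasContent? α σ = all? λ j → count (_≟ j) σ ℕ.≟ α j

-- Coefficient of x_1^{α 1} ⋯ x_k^{α k} in K_P(x): the number of
-- P-partitions σ with |σ⁻¹(j)| = α j for each j (values in {1..k}).
coeffK : ∀ {n} → NLPoset n → (k : ℕ) → (Fin k → ℕ) → ℕ
coeffK {n} P k α =
  length (filter (λ σ → isPPartition? P σ ×-dec hasContent? α σ) (allVecs n k))

-- K_P(x) = K_Q(x) as formal power series: all monomial coefficients agree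
-- (every monomial involves only finitely many variables x_1..x_k).
SameK : ∀ {n m} → NLPoset n → NLPoset m → Set
SameK P Q = ∀ k (α : Fin k → ℕ) → coeffK P k α ≡ coeffK Q k α

{-# OPTIONS --safe #-}
-- Disjoint union with a chain of r elements adds a row r to the shape, and ordinal sum with an
-- antichain of h elements adds a column h. Starting from (3,3,1), (3,3,2), (3,3,3) and (2,2,2,2)
-- these two operations reach every λ in question, and both preserve K_P = K_Q. For the four
-- initial pairs (found by computer search) there are elements a, b of P and c, d of Q such that
-- P with a ≤ b added equals Q with c ≤ d added, while P with b < a added is isomorphic to Q with
-- d < c added; summing over the two cases gives K_P = K_Q. Non-isomorphism survives because a
-- five-element poset that is neither a disjoint union nor an ordinal sum embeds in P and not in Q.
module Submission where

open import Defs
open import Data.Bool using (Bool; true; false; T; not; if_then_else_)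
open import Data.Bool.Properties using (T?)
open import Data.Empty using (⊥)
open import Data.Fin using (Fin; toℕ; _↑ˡ_; _↑ʳ_; splitAt; join)
import Data.Fin as F
import Data.Fin.Properties as F
open import Data.Fin.Patterns
open import Data.Fin.Permutation using (Permutation′; _⟨$⟩ʳ_; _⟨$⟩ˡ_; inverseʳ; permutation; flip)
open import Data.Fin.Subset using (Subset; _∈_; ⋃; ∣_∣; inside; outside)
open import Data.Fin.Subset.Properties using (_∈?_; x∈p∪q⁻; x∈p∪q⁺; ∉⊥)
import Data.Nat as ℕ
open import Data.List using (List; []; _∷_; length; allFin)
import Data.List as L
import Data.List.Membership.Propositional as L
open import Data.List.Membership.Propositional.Properties
  using (∈-∃++; ∈-++⁻; ∈-++⁺ˡ; ∈-++⁺ʳ; ∈-concatMap⁺; ∈-map⁺; ∈-map⁻; ∈-allFin; ∈-filter⁺; ∈-filter⁻)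
open import Data.List.Membership.DecPropositional ℕ._≟_ using () renaming (_∈?_ to _∈ℕ?_)
open import Data.List.Properties using (length-++-sucʳ)
open import Data.List.Relation.Binary.Permutation.Propositional using (_↭_)
open import Data.List.Relation.Binary.Permutation.Propositional.Properties using (map⁺; ++-comm)
open import Data.List.Relation.Unary.All as All using (All; []; _∷_)
import Data.List.Relation.Unary.All.Properties as All
open import Data.List.Relation.Unary.AllPairs as AllPairs using ([]; _∷_)
import Data.List.Relation.Unary.AllPairs.Properties as AllPairs
open import Data.List.Relation.Unary.Any as Any using (here; there)
open import Data.List.Relation.Unary.Linked as Linked using (Linked; []; _∷_)
open import Data.List.Relation.Unary.Unique.Propositional using (Unique)
import Data.List.Relation.Unary.Unique.Propositional.Properties as Unique
open import Data.Nat using (ℕ; zero; suc; _+_; _∸_; _⊓_; _≤_; _<_; z≤n; s≤s)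
import Data.Nat.ListAction as ListAction
open import Data.Nat.ListAction.Properties using (sum-↭)
open import Data.Nat.Properties
  using (≤-refl; ≤-trans; ≤-antisym; ≤-reflexive; <⇒≤; ≰⇒>; +-mono-≤; +-monoʳ-≤;
         m≤m+n; m≤n+m; +-suc; +-assoc; +-comm; m∸n+n≡m; ⊓-zeroʳ;
         ⊓-glb; m⊓n≤m; m⊓n≤n; _≤?_; <-cmp; suc-injective; +-0-commutativeMonoid; module ≤-Reasoning)
open import Data.Product using (Σ; ∃; ∃₂; _×_; _,_; proj₁; proj₂)
import Data.Sum as Sum
open import Data.Sum using (_⊎_; inj₁; inj₂; [_,_]′)
import Data.Vec as Vec
open import Data.Vec.Relation.Unary.All as VecAll using ([]; _∷_)
import Data.Vec.Relation.Unary.All.Properties as VecAll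
open import Data.Vec using (Vec; []; _∷_; lookup; tabulate; count; take; drop; _++_; toList)
open import Data.Vec.Properties
  using (lookup-splitAt; ++-injective; take++drop≡id; ∷-injective; ∷-injectiveʳ; lookup∘tabulate;
         tabulate∘lookup; tabulate-cong; lookup-map; lookup-++ˡ; map-id; map-∘; toList-++;
         toList∘fromList; []=⇒lookup; lookup⇒[]=)
open import Function using (_∘_)
open import Relation.Binary.Definitions using (tri<; tri≈; tri>)
open import Relation.Binary.PropositionalEquality
  using (_≡_; _≢_; cong; cong₂; subst; subst₂; module ≡-Reasoning)
import Relation.Binary.PropositionalEquality as ≡
open import Relation.Nullary using (Dec; yes; no; does; ¬_; contradiction)
open import Relation.Nullary.Decidable using (_×-dec_; _⊎-dec_; _→-dec_; ¬?; True; toWitness; from-yes; dec-true)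
open import Relation.Unary using (Decidable)

open import Algebra.Properties.CommutativeMonoid.Sum +-0-commutativeMonoid
  using (sum; ∑-comm; sum-permute; sum-cong-≗)

open NLPoset

-- Maximality over unions of antichains and non-isomorphism are awkward to push through a sum
-- directly. Each property of the pair is therefore replaced by a certificate that both operations
-- transport: content-preserving injections between P-partitions in both directions, an arrangement
-- of the elements in the cells of λ with chains as rows and antichains as columns, and an embedded
-- subposet. The choice of initial shapes is forced. Deleting any row or column from one of the four
-- leaves a diagram that contains neither (3,3,1) nor (2,2,2,2), so none of them can be built from a
-- smaller pair.

private
  variable
    c n r k m : ℕ

-- Equality of generating functions by injections

Unique-injection-length : ∀ {A B : Set} (f : A → B) {xs ys} → Unique xs →
  (∀ {x} → x L.∈ xs → f x L.∈ ys) →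
  (∀ {x y} → x L.∈ xs → y L.∈ xs → f x ≡ f y → x ≡ y) →
  length xs ≤ length ys
Unique-injection-length f []             into inj = z≤n
Unique-injection-length f {x ∷ xs} {ys} (x≢xs ∷ uniq) into inj
  with as , bs , ≡.refl ← ∈-∃++ (into (here ≡.refl)) =
  ≤-trans (s≤s (Unique-injection-length f uniq into′ (λ p q → inj (there p) (there q))))
          (≤-reflexive (≡.sym (length-++-sucʳ as (f x) bs)))
  where
  into′ : ∀ {y} → y L.∈ xs → f y L.∈ as L.++ bs
  into′ y∈xs with ∈-++⁻ as (into (there y∈xs))
  ... | inj₁ p               = ∈-++⁺ˡ p
  ... | inj₂ (here fy≡fx)    = contradiction (≡.sym (inj (there y∈xs) (here ≡.refl) fy≡fx)) (All.lookup x≢xs y∈xs)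
  ... | inj₂ (there p)       = ∈-++⁺ʳ as p

∈-allVecs : (v : Vec (Fin k) n) → v L.∈ allVecs n k
∈-allVecs []      = here ≡.refl
∈-allVecs (i ∷ v) =
  ∈-concatMap⁺ _ (Any.map (λ { ≡.refl → ∈-map⁺ _ (∈-allVecs v) }) (∈-allFin i))

allVecs-unique : ∀ n k → Unique (allVecs n k)
allVecs-unique zero    k = [] ∷ []
allVecs-unique (suc n) k = Unique.concat⁺
  (All.map⁺ (All.universal (λ i → Unique.map⁺ ∷-injectiveʳ (allVecs-unique n k)) (allFin k)))
  (AllPairs.map⁺ (AllPairs.map disjoint (Unique.allFin⁺ k)))
  where
  disjoint : ∀ {i j} → i ≢ j → ∀ {v} →
    ¬ (v L.∈ L.map (i ∷_) (allVecs n k) × v L.∈ L.map (j ∷_) (allVecs n k))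
  disjoint i≢j (p , q) with ∈-map⁻ _ p | ∈-map⁻ _ q
  ... | _ , _ , ≡.refl | _ , _ , eq = i≢j (proj₁ (∷-injective eq))

-- Injectivity is asked on P-partitions because the order relations are what separate the two cases
-- of an exchange. `lookup-to` says that no new value is created; this keeps the image above the
-- values on C in an ordinal sum.
record PPartitionInjection (P Q : NLPoset n) (k : ℕ) : Set where
  field
    to             : Vec (Fin k) n → Vec (Fin k) n
    preserves      : ∀ σ → IsPPartition P σ → IsPPartition Q (to σ)
    injective      : ∀ σ τ → IsPPartition P σ → IsPPartition P τ → to σ ≡ to τ → σ ≡ τ
    count-to       : ∀ σ j → count (F._≟ j) (to σ) ≡ count (F._≟ j) σ
    lookup-to      : ∀ σ x → ∃ λ y → lookup (to σ) x ≡ lookup σ y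

coeffK-mono : {P Q : NLPoset n} → PPartitionInjection P Q k →
  ∀ α → coeffK P k α ≤ coeffK Q k α
coeffK-mono {n = n} {k} {P} {Q} inj α =
  Unique-injection-length to (Unique.filter⁺ _ (allVecs-unique n k))
    (λ σ∈ → let _ , pp , ct = ∈-filter⁻ (counted? P) {xs = allVecs n k} σ∈ in
            ∈-filter⁺ (counted? Q) (∈-allVecs _)
              (preserves _ pp , λ j → ≡.trans (count-to _ j) (ct j)))
    (λ σ∈ τ∈ → injective _ _ (proj₁ (proj₂ (∈-filter⁻ (counted? P) {xs = allVecs n k} σ∈)))
                             (proj₁ (proj₂ (∈-filter⁻ (counted? P) {xs = allVecs n k} τ∈))))
  where
  open PPartitionInjection inj
  counted? : (R : NLPoset n) (σ : Vec (Fin k) n) → Dec (IsPPartition R σ × HasContent α σ)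
  counted? R σ = isPPartition? R σ ×-dec hasContent? α σ

sameK : {P Q : NLPoset n} → (∀ k → PPartitionInjection P Q k) →
  (∀ k → PPartitionInjection Q P k) → SameK P Q
sameK P⇝Q Q⇝P k α = ≤-antisym (coeffK-mono (P⇝Q k) α) (coeffK-mono (Q⇝P k) α)

-- Disjoint union for b = false, ordinal sum with C below P for b = true.
data Glued (b : Bool) (C : NLPoset c) (P : NLPoset n) : Fin c ⊎ Fin n → Fin c ⊎ Fin n → Set where
  inˡ : ∀ {x y} → _≼_ C x y → Glued b C P (inj₁ x) (inj₁ y)
  inʳ : ∀ {x y} → _≼_ P x y → Glued b C P (inj₂ x) (inj₂ y)
  across : ∀ {x y} → T b → Glued b C P (inj₁ x) (inj₂ y)

-- One construction with a flag lets injections and embeddings be transported by a single proof for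
-- both operations. C takes the first c labels, which keeps the sum naturally labeled when C lies
-- below P.
glue : Bool → NLPoset c → NLPoset n → NLPoset (c + n)
glue {c} {n} b C P = record
  { _≼_     = λ x y → Glued b C P (splitAt c x) (splitAt c y)
  ; _≼?_    = λ x y → glued? (splitAt c x) (splitAt c y)
  ; refl    = λ x → reflexive (splitAt c x)
  ; antisym = λ x y p q → ≡.trans (≡.sym (F.join-splitAt c n x))
                (≡.trans (cong (join c n) (antisymmetric p q)) (F.join-splitAt c n y))
  ; trans   = λ _ _ _ → transitive
  ; natural = λ x y p → subst₂ (λ u v → toℕ u ≤ toℕ v)
                (F.join-splitAt c n x) (F.join-splitAt c n y) (monotone p)
  }
  where
  G = Glued b C P
  glued? : ∀ s t → Dec (G s t)
  glued? (inj₁ x) (inj₁ y) with _≼?_ C x y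
  ... | yes p = yes (inˡ p)
  ... | no ¬p = no λ { (inˡ p) → ¬p p }
  glued? (inj₂ x) (inj₂ y) with _≼?_ P x y
  ... | yes p = yes (inʳ p)
  ... | no ¬p = no λ { (inʳ p) → ¬p p }
  glued? (inj₂ x) (inj₁ y) = no λ ()
  glued? (inj₁ x) (inj₂ y) with T? b
  ... | yes t = yes (across t)
  ... | no ¬t = no λ { (across t) → ¬t t }
  reflexive : ∀ s → G s s
  reflexive (inj₁ x) = inˡ (refl C x)
  reflexive (inj₂ x) = inʳ (refl P x)
  antisymmetric : ∀ {s t} → G s t → G t s → s ≡ t
  antisymmetric (inˡ p) (inˡ q) = cong inj₁ (antisym C _ _ p q)
  antisymmetric (inʳ p) (inʳ q) = cong inj₂ (antisym P _ _ p q)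
  transitive : ∀ {s t u} → G s t → G t u → G s u
  transitive (inˡ p) (inˡ q) = inˡ (trans C _ _ _ p q)
  transitive (inˡ _) (across t) = across t
  transitive (inʳ p) (inʳ q) = inʳ (trans P _ _ _ p q)
  transitive (across t) (inʳ _) = across t
  monotone : ∀ {s t} → G s t → toℕ (join c n s) ≤ toℕ (join c n t)
  monotone {inj₁ x} {inj₁ y} (inˡ p) =
    subst₂ _≤_ (≡.sym (F.toℕ-↑ˡ x n)) (≡.sym (F.toℕ-↑ˡ y n)) (natural C _ _ p)
  monotone {inj₂ x} {inj₂ y} (inʳ p) =
    subst₂ _≤_ (≡.sym (F.toℕ-↑ʳ c x)) (≡.sym (F.toℕ-↑ʳ c y)) (+-monoʳ-≤ c (natural P _ _ p))
  monotone {inj₁ x} {inj₂ y} (across _) =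
    subst₂ _≤_ (≡.sym (F.toℕ-↑ˡ x n)) (≡.sym (F.toℕ-↑ʳ c y)) (≤-trans (<⇒≤ (F.toℕ<n x)) (m≤m+n c (toℕ y)))

module _ {b : Bool} {C : NLPoset c} {P : NLPoset n} where

  private
    value : Vec (Fin k) c → Vec (Fin k) n → Fin c ⊎ Fin n → Fin k
    value τ σ = [ lookup τ , lookup σ ]′

  IsPPartition-glue⁺ : ∀ (τ : Vec (Fin k) c) σ →
    (∀ s t → Glued b C P s t → value τ σ s F.≤ value τ σ t) →
    IsPPartition (glue b C P) (τ ++ σ)
  IsPPartition-glue⁺ τ σ h x y p =
    subst₂ F._≤_ (≡.sym (lookup-splitAt c τ σ x)) (≡.sym (lookup-splitAt c τ σ y)) (h _ _ p)

  IsPPartition-glue⁻ : ∀ (τ : Vec (Fin k) c) σ → IsPPartition (glue b C P) (τ ++ σ) →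
    ∀ {s t} → Glued b C P s t → value τ σ s F.≤ value τ σ t
  IsPPartition-glue⁻ τ σ h {s} {t} p =
    subst₂ F._≤_ (value-join s) (value-join t)
      (h (join c n s) (join c n t)
        (subst₂ (Glued b C P) (≡.sym (F.splitAt-join c n s)) (≡.sym (F.splitAt-join c n t)) p))
    where
    value-join : ∀ s → lookup (τ ++ σ) (join c n s) ≡ value τ σ s
    value-join s = ≡.trans (lookup-splitAt c τ σ (join c n s)) (cong (value τ σ) (F.splitAt-join c n s))

count-++ : ∀ {A : Set} {Q : A → Set} (Q? : Decidable Q) (xs : Vec A m) (ys : Vec A n) →
  count Q? (xs ++ ys) ≡ count Q? xs + count Q? ys
count-++ Q? []       ys = ≡.refl
count-++ Q? (x ∷ xs) ys with does (Q? x)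
... | true  = cong suc (count-++ Q? xs ys)
... | false = count-++ Q? xs ys

glue-injection : ∀ b (C : NLPoset c) {P Q : NLPoset n} →
  PPartitionInjection P Q k → PPartitionInjection (glue b C P) (glue b C Q) k
glue-injection {c} {n} {k} b C {P} {Q} inj = record
  { to        = to′
  ; preserves = λ v pp → IsPPartition-glue⁺ (take c v) (to (drop c v)) λ
      { _ _ (inˡ p)           → parts v pp (inˡ p)
      ; _ _ (inʳ p)           → preserves _ (λ _ _ q → parts v pp (inʳ q)) _ _ p
      -- The value of the image at y is the old value at some z of P, and x lies below z just as it
      -- lies below y.
      ; _ _ (across {x} {y} t)   → let z , eq = lookup-to (drop c v) y in
                                  subst (lookup (take c v) x F.≤_) (≡.sym eq) (parts v pp (across t))
      }
  ; injective = λ v w ppv ppw eq →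
      let eqˡ , eqʳ = ++-injective (take c v) (take c w) eq in
      ≡.trans (≡.sym (take++drop≡id c v))
        (≡.trans (cong₂ _++_ eqˡ (injective _ _ (λ _ _ q → parts v ppv (inʳ q))
                                               (λ _ _ q → parts w ppw (inʳ q)) eqʳ))
                 (take++drop≡id c w))
  ; count-to  = λ v j → begin
      count (F._≟ j) (take c v ++ to (drop c v))                  ≡⟨ count-++ (F._≟ j) (take c v) _ ⟩
      count (F._≟ j) (take c v) + count (F._≟ j) (to (drop c v))  ≡⟨ cong (_ +_) (count-to (drop c v) j) ⟩
      count (F._≟ j) (take c v) + count (F._≟ j) (drop c v)       ≡⟨ count-++ (F._≟ j) (take c v) _ ⟨
      count (F._≟ j) (take c v ++ drop c v)                       ≡⟨ cong (count (F._≟ j)) (take++drop≡id c v) ⟩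
      count (F._≟ j) v                                            ∎
  ; lookup-to = λ v x → let y , eq = source v (splitAt c x) in
      y , ≡.trans (lookup-splitAt c (take c v) (to (drop c v)) x) eq
  }
  where
  open PPartitionInjection inj
  open ≡-Reasoning
  to′ : Vec (Fin k) (c + n) → Vec (Fin k) (c + n)
  to′ v = take c v ++ to (drop c v)
  parts : ∀ v → IsPPartition (glue b C P) v → ∀ {s t} → Glued b C P s t →
    [ lookup (take c v) , lookup (drop c v) ]′ s F.≤ [ lookup (take c v) , lookup (drop c v) ]′ t
  parts v pp = IsPPartition-glue⁻ (take c v) (drop c v)
    (subst (IsPPartition (glue b C P)) (≡.sym (take++drop≡id c v)) pp)
  at : ∀ v s → lookup v (join c n s) ≡ [ lookup (take c v) , lookup (drop c v) ]′ s
  at v s = ≡.trans (cong (λ w → lookup w (join c n s)) (≡.sym (take++drop≡id c v)))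
    (≡.trans (lookup-splitAt c (take c v) (drop c v) (join c n s))
             (cong [ lookup (take c v) , lookup (drop c v) ]′ (F.splitAt-join c n s)))
  source : ∀ v s → ∃ λ y → [ lookup (take c v) , lookup (to (drop c v)) ]′ s ≡ lookup v y
  source v (inj₁ x) = _ , ≡.sym (at v (inj₁ x))
  source v (inj₂ x) = let y , eq = lookup-to (drop c v) x in _ , ≡.trans eq (≡.sym (at v (inj₂ y)))

-- Exchanging one comparison for another

-- The transitive closure of P with a ≤ b adjoined: a path that uses the new edge repeatedly can be
-- shortened to use it once.
Forced : NLPoset n → Fin n → Fin n → Fin n → Fin n → Set
Forced P a b x y = _≼_ P x y ⊎ (_≼_ P x a × _≼_ P b y)

-- Only one inclusion of relations is required, since it yields an injection one way; the converse
-- comes from a second exchange with P and Q interchanged. The last two conditions turn σ(b) < σ(a)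
-- into σ(ρ d) < σ(ρ c), the opposite of what the second condition gives when σ(a) ≤ σ(b).
Exchange : NLPoset n → NLPoset n → (a b c d : Fin n) → Permutation′ n → Set
Exchange P Q a b c d ρ =
  (∀ x y → _≼_ Q x y → Forced P a b x y) ×
  Forced P a b c d ×
  (∀ x y → _≼_ Q x y → Forced P b a (ρ ⟨$⟩ʳ x) (ρ ⟨$⟩ʳ y)) ×
  _≼_ P (ρ ⟨$⟩ʳ d) b × _≼_ P a (ρ ⟨$⟩ʳ c)

exchange? : ∀ (P Q : NLPoset n) a b c d ρ → Dec (Exchange P Q a b c d ρ)
exchange? P Q a b c d ρ =
  F.all? (λ x → F.all? λ y → _≼?_ Q x y →-dec forced? a b x y) ×-dec
  forced? a b c d ×-dec
  F.all? (λ x → F.all? λ y → _≼?_ Q x y →-dec forced? b a (ρ ⟨$⟩ʳ x) (ρ ⟨$⟩ʳ y)) ×-dec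
  _≼?_ P (ρ ⟨$⟩ʳ d) b ×-dec _≼?_ P a (ρ ⟨$⟩ʳ c)
  where
  forced? : ∀ a b x y → Dec (Forced P a b x y)
  forced? a b x y = _≼?_ P x y ⊎-dec (_≼?_ P x a ×-dec _≼?_ P b y)

forced-≤ : ∀ {P : NLPoset n} {a b x y} (σ : Vec (Fin k) n) → IsPPartition P σ →
  lookup σ a F.≤ lookup σ b → Forced P a b x y → lookup σ x F.≤ lookup σ y
forced-≤ σ pp a≤b (inj₁ x≼y)         = pp _ _ x≼y
forced-≤ σ pp a≤b (inj₂ (x≼a , b≼y)) = ≤-trans (pp _ _ x≼a) (≤-trans a≤b (pp _ _ b≼y))

permute : Permutation′ n → Vec (Fin k) n → Vec (Fin k) n
permute ρ σ = tabulate λ x → lookup σ (ρ ⟨$⟩ʳ x)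

lookup-permute : ∀ (ρ : Permutation′ n) (σ : Vec (Fin k) n) x →
  lookup (permute ρ σ) x ≡ lookup σ (ρ ⟨$⟩ʳ x)
lookup-permute ρ σ = lookup∘tabulate _

permute-injective : ∀ (ρ : Permutation′ n) (σ τ : Vec (Fin k) n) →
  permute ρ σ ≡ permute ρ τ → σ ≡ τ
permute-injective ρ σ τ eq = ≡.trans (≡.sym (tabulate∘lookup σ))
  (≡.trans (tabulate-cong pointwise) (tabulate∘lookup τ))
  where
  open ≡-Reasoning
  pointwise : ∀ x → lookup σ x ≡ lookup τ x
  pointwise x = begin
    lookup σ x                          ≡⟨ cong (lookup σ) (inverseʳ ρ) ⟨
    lookup σ (ρ ⟨$⟩ʳ (ρ ⟨$⟩ˡ x))        ≡⟨ lookup-permute ρ σ (ρ ⟨$⟩ˡ x) ⟨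
    lookup (permute ρ σ) (ρ ⟨$⟩ˡ x)     ≡⟨ cong (λ v → lookup v (ρ ⟨$⟩ˡ x)) eq ⟩
    lookup (permute ρ τ) (ρ ⟨$⟩ˡ x)     ≡⟨ lookup-permute ρ τ (ρ ⟨$⟩ˡ x) ⟩
    lookup τ (ρ ⟨$⟩ʳ (ρ ⟨$⟩ˡ x))        ≡⟨ cong (lookup τ) (inverseʳ ρ) ⟩
    lookup τ x                          ∎

indicator : ∀ {A : Set} → Dec A → ℕ
indicator d = if does d then 1 else 0

count-sum : ∀ {A : Set} {Q : A → Set} (Q? : Decidable Q) (v : Vec A n) →
  count Q? v ≡ sum (λ x → indicator (Q? (lookup v x)))
count-sum Q? []      = ≡.refl
count-sum Q? (x ∷ v) with does (Q? x)
... | true  = cong suc (count-sum Q? v)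
... | false = count-sum Q? v

count-permute : ∀ (ρ : Permutation′ n) (σ : Vec (Fin k) n) j →
  count (F._≟ j) (permute ρ σ) ≡ count (F._≟ j) σ
count-permute ρ σ j = begin
  count (F._≟ j) (permute ρ σ)                              ≡⟨ count-sum (F._≟ j) (permute ρ σ) ⟩
  sum (λ x → indicator (lookup (permute ρ σ) x F.≟ j))      ≡⟨ sum-cong-≗ (λ x → cong (λ i → indicator (i F.≟ j)) (lookup-permute ρ σ x)) ⟩
  sum (λ x → indicator (lookup σ (ρ ⟨$⟩ʳ x) F.≟ j))         ≡⟨ sum-permute (λ x → indicator (lookup σ x F.≟ j)) ρ ⟨
  sum (λ x → indicator (lookup σ x F.≟ j))                  ≡⟨ count-sum (F._≟ j) σ ⟨
  count (F._≟ j) σ                                          ∎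
  where open ≡-Reasoning

-- σ is sent to itself when σ(a) ≤ σ(b) and to σ ∘ ρ otherwise; comparing the values of the
-- image at c and d tells the two cases apart.
exchange-injection : ∀ {P Q : NLPoset n} {a b c d ρ} → Exchange P Q a b c d ρ →
  ∀ k → PPartitionInjection P Q k
exchange-injection {n} {P} {Q} {a} {b} {c} {d} {ρ} (weak , weak-cd , strict , d≼b , a≼c) k = record
  { to        = to
  ; preserves = preserves
  ; injective = injective
  ; count-to  = count-to
  ; lookup-to = lookup-to
  }
  where
  to : Vec (Fin k) n → Vec (Fin k) n
  to σ with lookup σ a F.≤? lookup σ b
  ... | yes _ = σ
  ... | no  _ = permute ρ σ

  preserves : ∀ σ → IsPPartition P σ → IsPPartition Q (to σ)
  preserves σ pp x y x≼y with lookup σ a F.≤? lookup σ b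
  ... | yes a≤b = forced-≤ {P = P} σ pp a≤b (weak x y x≼y)
  ... | no  a≰b rewrite lookup-permute ρ σ x | lookup-permute ρ σ y =
    -- Order preservation uses only the weak form of σ(b) < σ(a); the strict form is used in
    -- `permuted-c≰d`.
    forced-≤ {P = P} σ pp (<⇒≤ (≰⇒> a≰b)) (strict x y x≼y)

  permuted-c≰d : ∀ σ → IsPPartition P σ → ¬ lookup σ a F.≤ lookup σ b →
    ¬ lookup (permute ρ σ) c F.≤ lookup (permute ρ σ) d
  permuted-c≰d σ pp a≰b c≤d rewrite lookup-permute ρ σ c | lookup-permute ρ σ d =
    a≰b (≤-trans (pp _ _ a≼c) (≤-trans c≤d (pp _ _ d≼b)))

  injective : ∀ σ τ → IsPPartition P σ → IsPPartition P τ → to σ ≡ to τ → σ ≡ τ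
  injective σ τ ppσ ppτ eq with lookup σ a F.≤? lookup σ b | lookup τ a F.≤? lookup τ b
  ... | yes _   | yes _   = eq
  ... | no  _   | no  _   = permute-injective ρ σ τ eq
  ... | yes a≤b | no  a≰b = contradiction
    (subst (λ v → lookup v c F.≤ lookup v d) eq (forced-≤ {P = P} σ ppσ a≤b weak-cd))
    (permuted-c≰d τ ppτ a≰b)
  ... | no  a≰b | yes a≤b = contradiction
    (subst (λ v → lookup v c F.≤ lookup v d) (≡.sym eq) (forced-≤ {P = P} τ ppτ a≤b weak-cd))
    (permuted-c≰d σ ppσ a≰b)

  count-to : ∀ σ j → count (F._≟ j) (to σ) ≡ count (F._≟ j) σ
  count-to σ j with lookup σ a F.≤? lookup σ b
  ... | yes _ = ≡.refl
  ... | no  _ = count-permute ρ σ j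

  lookup-to : ∀ σ x → ∃ λ y → lookup (to σ) x ≡ lookup σ y
  lookup-to σ x with lookup σ a F.≤? lookup σ b
  ... | yes _ = x , ≡.refl
  ... | no  _ = ρ ⟨$⟩ʳ x , lookup-permute ρ σ x

-- Counting by sums of indicators

sum-mono : ∀ {f g : Fin n → ℕ} → (∀ x → f x ≤ g x) → sum f ≤ sum g
sum-mono {zero}  h = z≤n
sum-mono {suc n} h = +-mono-≤ (h F.zero) (sum-mono (h ∘ F.suc))

≤-sum : ∀ (f : Fin n → ℕ) x → f x ≤ sum f
≤-sum f F.zero    = m≤m+n _ _
≤-sum f (F.suc x) = ≤-trans (≤-sum (f ∘ F.suc) x) (m≤n+m _ _)

sum-const-1 : ∀ n → sum {n} (λ _ → 1) ≡ n
sum-const-1 zero    = ≡.refl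
sum-const-1 (suc n) = cong suc (sum-const-1 n)

does-true : ∀ {A : Set} (d : Dec A) → does d ≡ true → A
does-true (yes a) _ = a

indicator-yes : ∀ {A : Set} (d : Dec A) → A → indicator d ≡ 1
indicator-yes (yes _) _ = ≡.refl
indicator-yes (no ¬a) a = contradiction a ¬a

indicator-no : ∀ {A : Set} (d : Dec A) → ¬ A → indicator d ≡ 0
indicator-no (yes a) ¬a = contradiction a ¬a
indicator-no (no _)  _  = ≡.refl

indicator-≤ : ∀ {A : Set} (d : Dec A) {m} → (A → 1 ≤ m) → indicator d ≤ m
indicator-≤ (yes a) h = h a
indicator-≤ (no _)  h = z≤n

sum-none : ∀ {Q : Fin n → Set} (Q? : Decidable Q) → (∀ x → ¬ Q x) → sum (indicator ∘ Q?) ≡ 0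
sum-none {zero}  Q? none = ≡.refl
sum-none {suc n} Q? none =
  cong₂ _+_ (indicator-no (Q? F.zero) (none F.zero)) (sum-none (Q? ∘ F.suc) (none ∘ F.suc))

sum-unique-≤1 : ∀ {Q : Fin n → Set} (Q? : Decidable Q) →
  (∀ x y → Q x → Q y → x ≡ y) → sum (indicator ∘ Q?) ≤ 1
sum-unique-≤1 {zero}  Q? unique = z≤n
sum-unique-≤1 {suc n} Q? unique with Q? F.zero
... | yes q = s≤s (≤-reflexive (sum-none (Q? ∘ F.suc) λ x qx → F.0≢1+n (unique F.zero (F.suc x) q qx)))
... | no  _ = sum-unique-≤1 (Q? ∘ F.suc) λ x y qx qy → F.suc-injective (unique _ _ qx qy)

module _ {Q : Fin n → Set} {R : Fin n → Fin m → Set}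
         (Q? : Decidable Q) (R? : ∀ x j → Dec (R x j)) where

  -- Double counting of R: every x in Q lies in at least one pair, every j in at most one. A
  -- relation is used instead of a function because an element may belong to several of the given
  -- antichains.
  count-≤-by-relation : (∀ x → Q x → ∃ (R x)) → (∀ j x y → R x j → R y j → x ≡ y) →
    sum (indicator ∘ Q?) ≤ m
  count-≤-by-relation total injective = begin
    sum (indicator ∘ Q?)                        ≤⟨ sum-mono (λ x → indicator-≤ (Q? x) (hit x)) ⟩
    sum (λ x → sum (λ j → indicator (R? x j)))  ≡⟨ ∑-comm (λ x j → indicator (R? x j)) ⟩
    sum (λ j → sum (λ x → indicator (R? x j)))  ≤⟨ sum-mono (λ j → sum-unique-≤1 (λ x → R? x j) (injective j)) ⟩
    sum {m} (λ _ → 1)                           ≡⟨ sum-const-1 m ⟩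
    m                                           ∎
    where
    open ≤-Reasoning
    hit : ∀ x → Q x → 1 ≤ sum (λ j → indicator (R? x j))
    hit x q = let j , p = total x q in
      ≤-trans (≤-reflexive (≡.sym (indicator-yes (R? x j) p))) (≤-sum (indicator ∘ R? x) j)

  count-≥-by-relation : (∀ j → ∃ λ x → R x j) → (∀ x j → R x j → Q x) →
    (∀ x i j → R x i → R x j → i ≡ j) → m ≤ sum (indicator ∘ Q?)
  count-≥-by-relation surjective sound functional = begin
    m                                           ≡⟨ sum-const-1 m ⟨
    sum {m} (λ _ → 1)                           ≤⟨ sum-mono hit ⟩
    sum (λ j → sum (λ x → indicator (R? x j)))  ≡⟨ ∑-comm (λ x j → indicator (R? x j)) ⟨
    sum (λ x → sum (λ j → indicator (R? x j)))  ≤⟨ sum-mono bound ⟩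
    sum (indicator ∘ Q?)                        ∎
    where
    open ≤-Reasoning
    hit : ∀ j → 1 ≤ sum (λ x → indicator (R? x j))
    hit j = let x , p = surjective j in
      ≤-trans (≤-reflexive (≡.sym (indicator-yes (R? x j) p))) (≤-sum (λ x → indicator (R? x j)) x)
    bound : ∀ x → sum (λ j → indicator (R? x j)) ≤ indicator (Q? x)
    bound x with Q? x
    ... | yes _ = sum-unique-≤1 (R? x) (functional x)
    ... | no ¬q = ≤-reflexive (sum-none (R? x) λ j p → ¬q (sound x j p))

card-sum : (S : Subset n) → ∣ S ∣ ≡ sum (λ x → indicator (x ∈? S))
card-sum []            = ≡.refl
card-sum (inside  ∷ S) = cong suc (card-sum S)
card-sum (outside ∷ S) = card-sum S

x∈⋃⁻ : ∀ {x : Fin n} (As : Vec (Subset n) k) → x ∈ ⋃ (toList As) → ∃ λ j → x ∈ lookup As j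
x∈⋃⁻ []       x∈ = contradiction x∈ ∉⊥
x∈⋃⁻ (A ∷ As) x∈ with x∈p∪q⁻ A (⋃ (toList As)) x∈
... | inj₁ x∈A  = F.zero , x∈A
... | inj₂ x∈As = let j , p = x∈⋃⁻ As x∈As in F.suc j , p

x∈⋃⁺ : ∀ {x : Fin n} (As : Vec (Subset n) k) j → x ∈ lookup As j → x ∈ ⋃ (toList As)
x∈⋃⁺ (A ∷ As) F.zero    x∈ = x∈p∪q⁺ (inj₁ x∈)
x∈⋃⁺ (A ∷ As) (F.suc j) x∈ = x∈p∪q⁺ {p = A} (inj₂ (x∈⋃⁺ As j x∈))

-- Conjugate partial sums and shapes from fillings

⊓-suc : ∀ x i → x ⊓ suc i ≡ (if does (suc i ≤? x) then 1 else 0) + x ⊓ i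
⊓-suc zero    zero    = ≡.refl
⊓-suc zero    (suc i) = ≡.refl
⊓-suc (suc x) zero    = cong suc (⊓-zeroʳ x)
⊓-suc (suc x) (suc i) = ≡.trans (cong suc (⊓-suc x i)) (≡.sym (+-suc _ _))

-- The first i columns of a diagram meet a row of length x in min(x, i) cells. This form treats the
-- rows separately and makes their order irrelevant.
conjSum-⊓ : ∀ la i → conjSum la i ≡ ListAction.sum (L.map (_⊓ i) la)
conjSum-⊓ la zero    = ≡.sym (none la)
  where
  none : ∀ la → ListAction.sum (L.map (_⊓ 0) la) ≡ 0
  none []       = ≡.refl
  none (x ∷ la) = cong₂ _+_ (⊓-zeroʳ x) (none la)
conjSum-⊓ la (suc i) = ≡.trans (cong (_+ conjPart la (suc i)) (conjSum-⊓ la i)) (step la)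
  where
  open ≡-Reasoning
  step : ∀ la → ListAction.sum (L.map (_⊓ i) la) + conjPart la (suc i) ≡ ListAction.sum (L.map (_⊓ suc i) la)
  step []       = ≡.refl
  step (x ∷ la) with does (suc i ≤? x) | ⊓-suc x i | step la
  ... | true  | eq | ih = begin
    x ⊓ i + ListAction.sum (L.map (_⊓ i) la) + suc (conjPart la (suc i))    ≡⟨ +-suc _ _ ⟩
    suc (x ⊓ i + ListAction.sum (L.map (_⊓ i) la) + conjPart la (suc i))    ≡⟨ cong suc (+-assoc (x ⊓ i) _ _) ⟩
    suc (x ⊓ i) + (ListAction.sum (L.map (_⊓ i) la) + conjPart la (suc i))  ≡⟨ cong₂ _+_ (≡.sym eq) ih ⟩
    x ⊓ suc i + ListAction.sum (L.map (_⊓ suc i) la)                        ∎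
  ... | false | eq | ih = begin
    x ⊓ i + ListAction.sum (L.map (_⊓ i) la) + conjPart la (suc i)          ≡⟨ +-assoc (x ⊓ i) _ _ ⟩
    x ⊓ i + (ListAction.sum (L.map (_⊓ i) la) + conjPart la (suc i))        ≡⟨ cong₂ _+_ (≡.sym eq) ih ⟩
    x ⊓ suc i + ListAction.sum (L.map (_⊓ suc i) la)                        ∎

-- Rows added to a pair are put in front, although they are the last rows of λ; this allows them to
-- be moved back.
conjSum-↭ : ∀ {la mu} → la ↭ mu → ∀ i → conjSum la i ≡ conjSum mu i
conjSum-↭ {la} {mu} la↭mu i = ≡.trans (conjSum-⊓ la i)
  (≡.trans (sum-↭ (map⁺ (_⊓ i) la↭mu)) (≡.sym (conjSum-⊓ mu i)))

conjSum-toList : ∀ (la : Vec ℕ k) i → conjSum (toList la) i ≡ sum (λ j → lookup la j ⊓ i)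
conjSum-toList la i = ≡.trans (conjSum-⊓ (toList la) i) (go la)
  where
  go : ∀ {k} (la : Vec ℕ k) → ListAction.sum (L.map (_⊓ i) (toList la)) ≡ sum (λ j → lookup la j ⊓ i)
  go []       = ≡.refl
  go (x ∷ la) = cong (x ⊓ i +_) (go la)

-- A bijection with the cells of the diagram la whose rows are chains and whose columns are
-- antichains.
record Filling (P : NLPoset n) (la : Vec ℕ k) : Set where
  field
    row           : Fin n → Fin k
    col           : Fin n → ℕ
    row-chain     : ∀ x y → row x ≡ row y → _≼_ P x y ⊎ _≼_ P y x
    col-antichain : ∀ x y → col x ≡ col y → _≼_ P x y → x ≡ y
    col-bounded   : ∀ x → col x < lookup la (row x)
    cell          : ∀ i j → j < lookup la i → ∃ λ x → row x ≡ i × col x ≡ j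

-- i antichains meet each row in at most i elements, and the first i columns attain this bound
-- (and the length of the row) in every row simultaneously.
filling⇒shape : ∀ {P : NLPoset n} {la : Vec ℕ k} → Filling P la → HasShape P (toList la)
filling⇒shape {n} {k} {P} {la} filling i = (columns , columns-antichain , columns-size) , upper
  where
  open Filling filling
  open ≤-Reasoning

  inRow? : ∀ S r x → Dec (row x ≡ r × x ∈ S)
  inRow? S r x = row x F.≟ r ×-dec x ∈? S

  card-rows : ∀ S → ∣ S ∣ ≡ sum (λ r → sum (λ x → indicator (inRow? S r x)))
  card-rows S = begin-equality
    ∣ S ∣                                                   ≡⟨ card-sum S ⟩
    sum (λ x → indicator (x ∈? S))                          ≡⟨ sum-cong-≗ split ⟩
    sum (λ x → sum (λ r → indicator (inRow? S r x)))        ≡⟨ ∑-comm (λ x r → indicator (inRow? S r x)) ⟩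
    sum (λ r → sum (λ x → indicator (inRow? S r x)))        ∎
    where
    split : ∀ x → indicator (x ∈? S) ≡ sum (λ r → indicator (inRow? S r x))
    split x = ≤-antisym
      (indicator-≤ (x ∈? S) λ x∈S →
        ≤-trans (≤-reflexive (≡.sym (indicator-yes (inRow? S (row x) x) (≡.refl , x∈S))))
                (≤-sum (λ r → indicator (inRow? S r x)) (row x)))
      (bound (x ∈? S))
      where
      bound : (d : Dec (x ∈ S)) → sum (λ r → indicator (inRow? S r x)) ≤ indicator d
      bound (yes _)  = sum-unique-≤1 (λ r → inRow? S r x) λ _ _ p q → ≡.trans (≡.sym (proj₁ p)) (proj₁ q)
      bound (no x∉S) = ≤-reflexive (sum-none (λ r → inRow? S r x) λ _ p → x∉S (proj₂ p))

  upper : (As : Vec (Subset n) i) → (∀ j → IsAntichain P (lookup As j)) →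
    ∣ ⋃ (toList As) ∣ ≤ conjSum (toList la) i
  upper As antichain = begin
    ∣ U ∣                                               ≡⟨ card-rows U ⟩
    sum (λ r → sum (λ x → indicator (inRow? U r x)))    ≤⟨ sum-mono (λ r → ⊓-glb (by-cells r) (by-antichains r)) ⟩
    sum (λ r → lookup la r ⊓ i)                         ≡⟨ conjSum-toList la i ⟨
    conjSum (toList la) i                               ∎
    where
    U = ⋃ (toList As)
    by-cells : ∀ r → sum (λ x → indicator (inRow? U r x)) ≤ lookup la r
    by-cells r = count-≤-by-relation (inRow? U r) (λ x j → row x F.≟ r ×-dec col x ℕ.≟ toℕ j)
      (λ { x (≡.refl , _) → F.fromℕ< (col-bounded x) , ≡.refl , ≡.sym (F.toℕ-fromℕ< (col-bounded x)) })
      (λ j x y p q → same-cell (≡.trans (proj₁ p) (≡.sym (proj₁ q))) (≡.trans (proj₂ p) (≡.sym (proj₂ q))))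
      where
      same-cell : ∀ {x y} → row x ≡ row y → col x ≡ col y → x ≡ y
      same-cell {x} {y} rows cols with row-chain x y rows
      ... | inj₁ x≼y = col-antichain x y cols x≼y
      ... | inj₂ y≼x = ≡.sym (col-antichain y x (≡.sym cols) y≼x)
    by-antichains : ∀ r → sum (λ x → indicator (inRow? U r x)) ≤ i
    by-antichains r = count-≤-by-relation (inRow? U r) (λ x j → inRow? (lookup As j) r x)
      (λ x p → let j , q = x∈⋃⁻ As (proj₂ p) in j , proj₁ p , q)
      λ j x y p q → meet j (≡.trans (proj₁ p) (≡.sym (proj₁ q))) (proj₂ p) (proj₂ q)
      where
      meet : ∀ j {x y} → row x ≡ row y → x ∈ lookup As j → y ∈ lookup As j → x ≡ y
      meet j {x} {y} rows x∈ y∈ with row-chain x y rows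
      ... | inj₁ x≼y = antichain j x y x∈ y∈ x≼y
      ... | inj₂ y≼x = ≡.sym (antichain j y x y∈ x∈ y≼x)

  column : Fin i → Subset n
  column j = tabulate λ x → does (col x ℕ.≟ toℕ j)

  columns : Vec (Subset n) i
  columns = tabulate column

  x∈column⁻ : ∀ {x} j → x ∈ lookup columns j → col x ≡ toℕ j
  x∈column⁻ {x} j x∈ = does-true (col x ℕ.≟ toℕ j)
    (≡.trans (≡.sym (lookup∘tabulate _ x)) ([]=⇒lookup (subst (x ∈_) (lookup∘tabulate column j) x∈)))

  x∈column⁺ : ∀ {x} j → col x ≡ toℕ j → x ∈ lookup columns j
  x∈column⁺ {x} j eq = subst (x ∈_) (≡.sym (lookup∘tabulate column j))
    (lookup⇒[]= x _ (≡.trans (lookup∘tabulate (λ x → does (col x ℕ.≟ toℕ j)) x) (dec-true (col x ℕ.≟ toℕ j) eq)))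

  columns-antichain : ∀ j → IsAntichain P (lookup columns j)
  columns-antichain j x y x∈ y∈ = col-antichain x y (≡.trans (x∈column⁻ j x∈) (≡.sym (x∈column⁻ j y∈)))

  columns-size : ∣ ⋃ (toList columns) ∣ ≡ conjSum (toList la) i
  columns-size = ≤-antisym (upper columns columns-antichain) (begin
    conjSum (toList la) i                               ≡⟨ conjSum-toList la i ⟩
    sum (λ r → lookup la r ⊓ i)                         ≤⟨ sum-mono filled ⟩
    sum (λ r → sum (λ x → indicator (inRow? U r x)))    ≡⟨ card-rows U ⟨
    ∣ U ∣                                               ∎)
    where
    U = ⋃ (toList columns)
    filled : ∀ r → lookup la r ⊓ i ≤ sum (λ x → indicator (inRow? U r x))
    filled r = count-≥-by-relation (inRow? U r) (λ x j → row x F.≟ r ×-dec col x ℕ.≟ toℕ j)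
      (λ j → cell r (toℕ j) (≤-trans (F.toℕ<n j) (m⊓n≤m _ i)))
      (λ x j p → let j<i = ≤-trans (F.toℕ<n j) (m⊓n≤n (lookup la r) i) in
        proj₁ p , x∈⋃⁺ columns (F.fromℕ< j<i)
          (x∈column⁺ (F.fromℕ< j<i) (≡.trans (proj₂ p) (≡.sym (F.toℕ-fromℕ< j<i)))))
      (λ x j j′ p q → F.toℕ-injective (≡.trans (≡.sym (proj₂ p)) (proj₂ q)))

-- Embedded subposets

-- Reflection of the order together with antisymmetry makes such a map injective, so its image is an
-- induced subposet.
Embedding : NLPoset r → NLPoset n → Set
Embedding {r} {n} R P = Σ (Fin r → Fin n) λ f →
  ∀ x y → (_≼_ R x y → _≼_ P (f x) (f y)) × (_≼_ P (f x) (f y) → _≼_ R x y)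

-- The flag matches that of `glue`. Comparable elements cannot be on different sides of a disjoint
-- union, nor incomparable ones on different sides of an ordinal sum.
Tied : Bool → NLPoset r → Fin r → Fin r → Set
Tied false R x y = _≼_ R x y × x ≢ y
Tied true  R x y = ¬ _≼_ R x y × ¬ _≼_ R y x

tied? : ∀ b (R : NLPoset r) x y → Dec (Tied b R x y)
tied? false R x y = _≼?_ R x y ×-dec ¬? (x F.≟ y)
tied? true  R x y = ¬? (_≼?_ R x y) ×-dec ¬? (_≼?_ R y x)

-- Connectivity phrased through two-colourings, to be applied to the colouring that tells whether an
-- element lands in C.
Constant : NLPoset r → Bool → Set
Constant {r} R b = (s : Fin r → Bool) → (∀ x y → Tied b R x y → s x ≡ s y) → ∀ x y → s x ≡ s y

-- The comparability graph (b = false) and its complement (b = true) are both connected and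
-- both have an edge.
record Indecomposable (R : NLPoset r) : Set where
  field
    constant : ∀ b → Constant R b
    tied     : ∀ b → ∃₂ (Tied b R)

-- Repeated vertices are allowed because the comparability graph of `R₁` is a tree with three leaves
-- and has no Hamiltonian path.
walk⇒constant : ∀ b {R : NLPoset r} (w : List (Fin r)) →
  Linked (λ x y → Tied b R x y ⊎ Tied b R y x) w → (∀ x → x L.∈ w) → Constant R b
walk⇒constant b {R} w linked covers s h x y = agree linked (covers x) (covers y)
  where
  along : ∀ {v w} → Linked (λ x y → Tied b R x y ⊎ Tied b R y x) (v ∷ w) →
    ∀ {x} → x L.∈ v ∷ w → s v ≡ s x
  along _              (here ≡.refl) = ≡.refl
  along (inj₁ t ∷ l)   (there x∈)    = ≡.trans (h _ _ t) (along l x∈)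
  along (inj₂ t ∷ l)   (there x∈)    = ≡.trans (≡.sym (h _ _ t)) (along l x∈)
  agree : ∀ {w} → Linked (λ x y → Tied b R x y ⊎ Tied b R y x) w →
    ∀ {x y} → x L.∈ w → y L.∈ w → s x ≡ s y
  agree {v ∷ w} l x∈ y∈ = ≡.trans (≡.sym (along l x∈)) (along l y∈)

embedding-glue⁺ : ∀ b (C : NLPoset c) {P : NLPoset n} {R : NLPoset r} →
  Embedding R P → Embedding R (glue b C P)
embedding-glue⁺ {c} {n} b C {P} (f , emb) = (λ x → c ↑ʳ f x) , λ x y →
  (λ p → subst₂ (Glued b C P) (≡.sym (F.splitAt-↑ʳ c n (f x))) (≡.sym (F.splitAt-↑ʳ c n (f y)))
           (inʳ (proj₁ (emb x y) p))) ,
  λ p → proj₂ (emb x y) (unʳ (subst₂ (Glued b C P) (F.splitAt-↑ʳ c n (f x)) (F.splitAt-↑ʳ c n (f y)) p))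
  where
  unʳ : ∀ {x y} → Glued b C P (inj₂ x) (inj₂ y) → _≼_ P x y
  unʳ (inʳ p) = p

-- Pairs tied in R cannot be separated by the gluing, so R lies on one side, and C is
-- too trivial to contain it.
embedding-glue⁻ : ∀ b (C : NLPoset c) {P : NLPoset n} {R : NLPoset r} → Indecomposable R →
  (∀ x y → ¬ Tied (not b) C x y) → Embedding R (glue b C P) → Embedding R P
embedding-glue⁻ {c} {n} {r} b C {P} {R} ind untied (f , emb) = conclude (side u) ≡.refl
  where
  open Indecomposable ind
  -- A pair tied for the opposite flag: incomparable in the case of a disjoint union, comparable and
  -- distinct in that of an ordinal sum. By `untied`, such a pair cannot lie in C.
  u v : Fin r
  u = proj₁ (tied (not b))
  v = proj₁ (proj₂ (tied (not b)))

  side : Fin r → Fin c ⊎ Fin n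
  side x = splitAt c (f x)

  isLower : Fin c ⊎ Fin n → Bool
  isLower = [ (λ _ → true) , (λ _ → false) ]′

  glued⁺ : ∀ {x y s t} → side x ≡ s → side y ≡ t → _≼_ R x y → Glued b C P s t
  glued⁺ ≡.refl ≡.refl p = proj₁ (emb _ _) p

  glued⁻ : ∀ {x y s t} → side x ≡ s → side y ≡ t → Glued b C P s t → _≼_ R x y
  glued⁻ ≡.refl ≡.refl p = proj₂ (emb _ _) p

  same-side : ∀ x y → Tied b R x y → isLower (side x) ≡ isLower (side y)
  same-side x y = split b ≡.refl (side x) (side y) ≡.refl ≡.refl
    where
    split : ∀ b′ → b ≡ b′ → ∀ s t → side x ≡ s → side y ≡ t → Tied b′ R x y → isLower s ≡ isLower t
    split _     _      (inj₁ _) (inj₁ _) _  _  _       = ≡.refl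
    split _     _      (inj₂ _) (inj₂ _) _  _  _       = ≡.refl
    split false ≡.refl (inj₁ _) (inj₂ _) ex ey (p , _) with glued⁺ ex ey p
    ... | across ()
    split false ≡.refl (inj₂ _) (inj₁ _) ex ey (p , _) with glued⁺ ex ey p
    ... | ()
    split true  ≡.refl (inj₁ _) (inj₂ _) ex ey (¬p , _) = contradiction (glued⁻ ex ey (across _)) ¬p
    split true  ≡.refl (inj₂ _) (inj₁ _) ex ey (_ , ¬q) = contradiction (glued⁻ ey ex (across _)) ¬q

  tied-below : ∀ b′ {x y p q} → side x ≡ inj₁ p → side y ≡ inj₁ q → Tied b′ R x y → Tied b′ C p q
  tied-below false ex ey (x≼y , x≢y) with glued⁺ ex ey x≼y
  ... | inˡ p≼q = p≼q , λ { ≡.refl → x≢y (antisym R _ _ x≼y (glued⁻ ey ex (inˡ (refl C _)))) }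
  tied-below true  ex ey (x⋠y , y⋠x) = (λ p → x⋠y (glued⁻ ex ey (inˡ p))) , λ q → y⋠x (glued⁻ ey ex (inˡ q))

  lower-side : ∀ s → isLower s ≡ true → ∃ λ p → s ≡ inj₁ p
  lower-side (inj₁ p) _ = p , ≡.refl

  upper-side : ∀ s → isLower s ≡ false → ∃ λ p → s ≡ inj₂ p
  upper-side (inj₂ p) _ = p , ≡.refl

  conclude : ∀ s → side u ≡ s → Embedding R P
  conclude (inj₁ p) eu =
    let q , ev = lower-side (side v) (≡.trans (constant b (isLower ∘ side) same-side v u) (cong isLower eu))
    in contradiction (tied-below (not b) eu ev (proj₂ (proj₂ (tied (not b))))) (untied p q)
  conclude (inj₂ p) eu = proj₁ ∘ above , λ x y →
    (λ x≼y → unʳ (glued⁺ (proj₂ (above x)) (proj₂ (above y)) x≼y)) ,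
    (λ p → glued⁻ (proj₂ (above x)) (proj₂ (above y)) (inʳ p))
    where
    above : ∀ x → ∃ λ q → side x ≡ inj₂ q
    above x = upper-side (side x) (≡.trans (constant b (isLower ∘ side) same-side x u) (cong isLower eu))
    unʳ : ∀ {x y} → Glued b C P (inj₂ x) (inj₂ y) → _≼_ P x y
    unʳ (inʳ p) = p

-- Elements of R are placed one at a time, in the order given by the list.
Matches : NLPoset r → NLPoset n → Fin r × Fin n → Fin r × Fin n → Set
Matches R P (i , x) (j , y) =
  (_≼_ R i j → _≼_ P x y) × (_≼_ P x y → _≼_ R i j) ×
  (_≼_ R j i → _≼_ P y x) × (_≼_ P y x → _≼_ R j i)

Avoids : NLPoset r → NLPoset n → List (Fin r) → List (Fin r × Fin n) → Set
Avoids R P []       placed = ⊥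
Avoids R P (i ∷ is) placed = ∀ x → All (Matches R P (i , x)) placed → Avoids R P is ((i , x) ∷ placed)

-- The match with the elements already placed is tested before the recursive call, so bad partial
-- placements are pruned and the search can be evaluated.
avoids? : ∀ (R : NLPoset r) (P : NLPoset n) is placed → Dec (Avoids R P is placed)
avoids? R P []       placed = no λ ()
avoids? R P (i ∷ is) placed =
  F.all? λ x → All.all? (matches? (i , x)) placed →-dec avoids? R P is ((i , x) ∷ placed)
  where
  matches? : ∀ p q → Dec (Matches R P p q)
  matches? (i , x) (j , y) =
    (_≼?_ R i j →-dec _≼?_ P x y) ×-dec (_≼?_ P x y →-dec _≼?_ R i j) ×-dec
    (_≼?_ R j i →-dec _≼?_ P y x) ×-dec (_≼?_ P y x →-dec _≼?_ R j i)

-- An embedding is a branch of the search without mismatches; such a branch reaches the empty list,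
-- where `Avoids` is false.
avoids⇒¬embedding : ∀ {R : NLPoset r} {P : NLPoset n} is → Avoids R P is [] → ¬ Embedding R P
avoids⇒¬embedding {R = R} {P} is avoids (f , emb) = refute is [] avoids
  where
  refute : ∀ is js → Avoids R P is (L.map (λ j → j , f j) js) → ⊥
  refute []       js ()
  refute (i ∷ is) js avoids = refute is (i ∷ js)
    (avoids (f i) (All.map⁺ (All.universal (λ j → proj₁ (emb i j) , proj₂ (emb i j) , proj₁ (emb j i) , proj₂ (emb j i)) js)))

-- Fillings of the two sums

chain : ∀ n → NLPoset n
chain n = record
  { _≼_     = F._≤_
  ; _≼?_    = F._≤?_
  ; refl    = λ _ → ≤-refl
  ; antisym = λ _ _ → F.≤-antisym
  ; trans   = λ _ _ _ → ≤-trans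
  ; natural = λ _ _ p → p
  }

antichain : ∀ n → NLPoset n
antichain n = record
  { _≼_     = _≡_
  ; _≼?_    = F._≟_
  ; refl    = λ _ → ≡.refl
  ; antisym = λ _ _ p _ → p
  ; trans   = λ _ _ _ → ≡.trans
  ; natural = λ _ _ → ≤-reflexive ∘ cong toℕ
  }

module _ {b : Bool} {C : NLPoset c} {P : NLPoset n} {la : Vec ℕ k}
         (row : Fin c ⊎ Fin n → Fin k) (col : Fin c ⊎ Fin n → ℕ) where

  private
    G = Glued b C P

  filling-glue :
    (∀ s t → row s ≡ row t → G s t ⊎ G t s) →
    (∀ s t → col s ≡ col t → G s t → s ≡ t) →
    (∀ s → col s < lookup la (row s)) →
    (∀ i j → j < lookup la i → ∃ λ s → row s ≡ i × col s ≡ j) →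
    Filling (glue b C P) la
  filling-glue rows cols bounded cell = record
    { row           = row ∘ splitAt c
    ; col           = col ∘ splitAt c
    ; row-chain     = λ x y → rows (splitAt c x) (splitAt c y)
    ; col-antichain = λ x y eq p → ≡.trans (≡.sym (F.join-splitAt c n x))
        (≡.trans (cong (join c n) (cols _ _ eq p)) (F.join-splitAt c n y))
    ; col-bounded   = λ x → bounded (splitAt c x)
    ; cell          = λ i j j< → let s , r , q = cell i j j< in
        join c n s , ≡.trans (cong row (F.splitAt-join c n s)) r
                   , ≡.trans (cong col (F.splitAt-join c n s)) q
    }

-- The element j of the chain joins column j, which stays an antichain because no relation crosses a
-- disjoint union.
filling-addRow : ∀ {P : NLPoset n} {la : Vec ℕ k} m → Filling P la →
  Filling (glue false (chain m) P) (m ∷ la)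
filling-addRow {n} {k} {P} {la} m filling = filling-glue row′ col′
  (λ { (inj₁ x) (inj₁ y) _  → Sum.map inˡ inˡ (F.≤-total x y)
     ; (inj₂ x) (inj₂ y) eq → Sum.map inʳ inʳ (row-chain x y (F.suc-injective eq))
     })
  (λ { (inj₁ x) (inj₁ y) eq _       → cong inj₁ (F.toℕ-injective eq)
     ; (inj₂ x) (inj₂ y) eq (inʳ p) → cong inj₂ (col-antichain x y eq p)
     ; (inj₁ _) (inj₂ _) _  (across ())
     })
  (λ { (inj₁ x) → F.toℕ<n x ; (inj₂ x) → col-bounded x })
  λ { F.zero    j j< → inj₁ (F.fromℕ< j<) , ≡.refl , F.toℕ-fromℕ< j<
    ; (F.suc i) j j< → let x , r , q = cell i j j< in inj₂ x , cong F.suc r , q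
    }
  where
  open Filling filling
  row′ : Fin m ⊎ Fin n → Fin (suc k)
  row′ = [ (λ _ → F.zero) , F.suc ∘ row ]′
  col′ : Fin m ⊎ Fin n → ℕ
  col′ = [ toℕ , col ]′

-- The order embedding ℕ → ℕ that skips d.
skip : ℕ → ℕ → ℕ
skip zero    j       = suc j
skip (suc d) zero    = zero
skip (suc d) (suc j) = suc (skip d j)

skip-injective : ∀ d {i j} → skip d i ≡ skip d j → i ≡ j
skip-injective zero                      eq = suc-injective eq
skip-injective (suc d) {zero}  {zero}    eq = ≡.refl
skip-injective (suc d) {suc i} {suc j}   eq = cong suc (skip-injective d (suc-injective eq))

skip-≢ : ∀ d j → d ≢ skip d j
skip-≢ (suc d) (suc j) eq = skip-≢ d j (suc-injective eq)

skip-< : ∀ {d j} → j < d → skip d j ≡ j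
skip-< {suc d} {zero}  _         = ≡.refl
skip-< {suc d} {suc j} (s≤s j<d) = cong suc (skip-< j<d)

skip-≥ : ∀ {d j} → d ≤ j → skip d j ≡ suc j
skip-≥ {zero}          _         = ≡.refl
skip-≥ {suc d} {suc j} (s≤s d≤j) = cong suc (skip-≥ d≤j)

skip-≤ : ∀ d j → skip d j ≤ suc j
skip-≤ zero    j       = ≤-refl
skip-≤ (suc d) zero    = z≤n
skip-≤ (suc d) (suc j) = s≤s (skip-≤ d j)

-- The new antichain becomes column d, and the columns from d on move one place to the right.
filling-addColumn : ∀ {P : NLPoset n} {d} {xs : Vec ℕ m} {ys : Vec ℕ k} →
  VecAll.All (d ≤_) xs → VecAll.All (_≤ d) ys → Filling P (xs ++ ys) →
  Filling (glue true (antichain m) P) (Vec.map suc xs ++ ys)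
filling-addColumn {n} {m} {k} {P} {d} {xs} {ys} d≤xs ys≤d filling = filling-glue row′ col′
  (λ { (inj₁ x) (inj₁ y) eq → inj₁ (inˡ (F.↑ˡ-injective k x y eq))
     ; (inj₁ _) (inj₂ _) _  → inj₁ (across _)
     ; (inj₂ _) (inj₁ _) _  → inj₂ (across _)
     ; (inj₂ x) (inj₂ y) eq → Sum.map inʳ inʳ (row-chain x y eq)
     })
  (λ { (inj₁ x) (inj₁ y) _  (inˡ p)    → cong inj₁ p
     ; (inj₁ _) (inj₂ y) eq (across _) → contradiction eq (skip-≢ d (col y))
     ; (inj₂ x) (inj₂ y) eq (inʳ p)    → cong inj₂ (col-antichain x y (skip-injective d eq) p)
     })
  bounded
  filled
  where
  open Filling filling
  old new : Fin (m + k) → ℕ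
  old = lookup (xs ++ ys)
  new = lookup (Vec.map suc xs ++ ys)

  row′ : Fin m ⊎ Fin n → Fin (m + k)
  row′ = [ _↑ˡ k , row ]′
  col′ : Fin m ⊎ Fin n → ℕ
  col′ = [ (λ _ → d) , skip d ∘ col ]′

  -- A row that gains a cell already fills all columns before d, so no gap arises; any other row
  -- ends before column d and is not shifted.
  heights : ∀ i → (∃ λ j → j ↑ˡ k ≡ i × d ≤ old i × new i ≡ suc (old i)) ⊎ (old i ≤ d × new i ≡ old i)
  heights i rewrite lookup-splitAt m xs ys i | lookup-splitAt m (Vec.map suc xs) ys i
    with splitAt m i in eq
  ... | inj₁ j = inj₁ (j , F.splitAt⁻¹-↑ˡ eq , VecAll.lookup⁺ d≤xs j , lookup-map j suc xs)
  ... | inj₂ j = inj₂ (VecAll.lookup⁺ ys≤d j , ≡.refl)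

  bounded : ∀ s → col′ s < new (row′ s)
  bounded (inj₁ j) rewrite lookup-++ˡ (Vec.map suc xs) ys j | lookup-map j suc xs = s≤s (VecAll.lookup⁺ d≤xs j)
  bounded (inj₂ x) with heights (row x)
  ... | inj₁ (_ , _ , _ , eq) rewrite eq = s≤s (≤-trans (skip-≤ d (col x)) (col-bounded x))
  ... | inj₂ (old≤d , eq) rewrite eq | skip-< (≤-trans (col-bounded x) old≤d) = col-bounded x

  filled : ∀ i j → j < new i → ∃ λ s → row′ s ≡ i × col′ s ≡ j
  filled i j j< with heights i
  ... | inj₂ (old≤d , eq) rewrite eq =
    let x , r , q = cell i j j< in inj₂ x , r , ≡.trans (cong (skip d) q) (skip-< (≤-trans j< old≤d))
  ... | inj₁ (l , l≡i , d≤old , eq) rewrite eq with <-cmp j d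
  ...   | tri< j<d _ _ =
    let x , r , q = cell i j (≤-trans j<d d≤old) in inj₂ x , r , ≡.trans (cong (skip d) q) (skip-< j<d)
  ...   | tri≈ _ ≡.refl _ = inj₁ l , l≡i , ≡.refl
  filled i (suc j) (s≤s j<) | inj₁ _ | tri> _ _ (s≤s d≤j) =
    let x , r , q = cell i j j< in inj₂ x , r , ≡.trans (cong (skip d) q) (skip-≥ d≤j)

-- Pairs and their extension by rows and columns

-- The invariant of the construction. The separator never changes: its embedding in P is carried up
-- into the sum, and one in the sum with Q would be pulled back to Q.
record EquivalentPair (la : Vec ℕ k) : Set₁ where
  field
    {size}          : ℕ
    {P Q}           : NLPoset size
    P⇝Q             : ∀ k → PPartitionInjection P Q k
    Q⇝P             : ∀ k → PPartitionInjection Q P k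
    fillingP        : Filling P la
    fillingQ        : Filling Q la
    {separatorSize}   : ℕ
    {separator}      : NLPoset separatorSize
    indecomposable  : Indecomposable separator
    inP             : Embedding separator P
    notInQ          : ¬ Embedding separator Q

addRow : ∀ {la : Vec ℕ k} m → EquivalentPair la → EquivalentPair (m ∷ la)
addRow m pair = record
  { P⇝Q            = λ k → glue-injection false (chain m) (P⇝Q k)
  ; Q⇝P            = λ k → glue-injection false (chain m) (Q⇝P k)
  ; fillingP       = filling-addRow m fillingP
  ; fillingQ       = filling-addRow m fillingQ
  ; indecomposable = indecomposable
  ; inP            = embedding-glue⁺ false (chain m) {R = separator} inP
  ; notInQ         = notInQ ∘ embedding-glue⁻ false (chain m) indecomposable
      λ x y (x≰y , y≰x) → [ x≰y , y≰x ]′ (F.≤-total x y)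
  }
  where open EquivalentPair pair

addColumn : ∀ {d} {xs : Vec ℕ m} {ys : Vec ℕ k} →
  VecAll.All (d ≤_) xs → VecAll.All (_≤ d) ys → EquivalentPair (xs ++ ys) → EquivalentPair (Vec.map suc xs ++ ys)
addColumn {m} d≤xs ys≤d pair = record
  { P⇝Q            = λ k → glue-injection true (antichain m) (P⇝Q k)
  ; Q⇝P            = λ k → glue-injection true (antichain m) (Q⇝P k)
  ; fillingP       = filling-addColumn d≤xs ys≤d fillingP
  ; fillingQ       = filling-addColumn d≤xs ys≤d fillingQ
  ; indecomposable = indecomposable
  ; inP            = embedding-glue⁺ true (antichain m) {R = separator} inP
  ; notInQ         = notInQ ∘ embedding-glue⁻ true (antichain m) indecomposable
      λ _ _ (x≡y , x≢y) → x≢y x≡y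
  }
  where open EquivalentPair pair

-- The four initial pairs

-- Entry y of a table lists the elements strictly below y.
Below : Vec (List ℕ) n → Fin n → Fin n → Set
Below t x y = x ≡ y ⊎ toℕ x L.∈ lookup t y

below? : (t : Vec (List ℕ) n) → ∀ x y → Dec (Below t x y)
below? t x y = x F.≟ y ⊎-dec toℕ x ∈ℕ? lookup t y

NaturalOrder : Vec (List ℕ) n → Set
NaturalOrder {n} t =
  (∀ y → All (_< toℕ y) (lookup t y)) ×
  (∀ x y z → Below t x y → Below t y z → Below t x z)

naturalOrder? : (t : Vec (List ℕ) n) → Dec (NaturalOrder t)
naturalOrder? t =
  F.all? (λ y → All.all? (λ x → x ℕ.<? toℕ y) (lookup t y)) ×-dec
  F.all? (λ x → F.all? λ y → F.all? λ z → below? t x y →-dec below? t y z →-dec below? t x z)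

fromTable : (t : Vec (List ℕ) n) {_ : True (naturalOrder? t)} → NLPoset n
fromTable t {ok} = record
  { _≼_     = Below t
  ; _≼?_    = below? t
  ; refl    = λ _ → inj₁ ≡.refl
  ; antisym = λ x y p q → F.toℕ-injective (≤-antisym (increasing x y p) (increasing y x q))
  ; trans   = proj₂ (toWitness ok)
  ; natural = increasing
  }
  where
  increasing : ∀ x y → Below t x y → toℕ x ≤ toℕ y
  increasing x y (inj₁ ≡.refl) = ≤-refl
  increasing x y (inj₂ x∈)     = <⇒≤ (All.lookup (proj₁ (toWitness ok) y) x∈)

embeddingFromTable : (R : NLPoset r) (P : NLPoset n) (f : Vec (Fin n) r)
  {_ : True (F.all? λ x → F.all? λ y →
    (_≼?_ R x y →-dec _≼?_ P (lookup f x) (lookup f y)) ×-dec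
    (_≼?_ P (lookup f x) (lookup f y) →-dec _≼?_ R x y))} →
  Embedding R P
embeddingFromTable R P f {ok} = lookup f , toWitness ok

fillingFromTable : (P : NLPoset n) (la : Vec ℕ k) (row : Vec (Fin k) n) (col : Vec ℕ n)
  {_ : True (F.all? λ x → F.all? λ y →
    lookup row x F.≟ lookup row y →-dec (_≼?_ P x y ⊎-dec _≼?_ P y x))}
  {_ : True (F.all? λ x → F.all? λ y →
    lookup col x ℕ.≟ lookup col y →-dec (_≼?_ P x y →-dec x F.≟ y))}
  {_ : True (F.all? λ x → lookup col x ℕ.<? lookup la (lookup row x))}
  {_ : True (F.all? λ i → F.all? {n = lookup la i} λ j →
    F.any? λ x → lookup row x F.≟ i ×-dec lookup col x ℕ.≟ toℕ j)} →
  Filling P la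
fillingFromTable P la row col {chains} {antichains} {bounded} {cells} = record
  { row           = lookup row
  ; col           = lookup col
  ; row-chain     = toWitness chains
  ; col-antichain = toWitness antichains
  ; col-bounded   = toWitness bounded
  ; cell          = λ i j j< → let x , r , q = toWitness cells i (F.fromℕ< j<) in
      x , r , ≡.trans q (F.toℕ-fromℕ< j<)
  }

permutationFromTable : (ρ ρ⁻¹ : Vec (Fin n) n)
  {_ : True (F.all? λ x → lookup ρ (lookup ρ⁻¹ x) F.≟ x)}
  {_ : True (F.all? λ x → lookup ρ⁻¹ (lookup ρ x) F.≟ x)} → Permutation′ n
permutationFromTable ρ ρ⁻¹ {invˡ} {invʳ} =
  permutation (lookup ρ) (lookup ρ⁻¹) (toWitness invˡ) (toWitness invʳ)

module _ (R : NLPoset r) where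

  Walk : Bool → List (Fin r) → Set
  Walk b w = Linked (λ x y → Tied b R x y ⊎ Tied b R y x) w × (∀ x → x L.∈ w)

  walk? : ∀ b w → Dec (Walk b w)
  walk? b w = Linked.linked? (λ x y → tied? b R x y ⊎-dec tied? b R y x) w ×-dec
              F.all? (λ x → Any.any? (x F.≟_) w)

  -- Each walk has at least two vertices because its first step also supplies the required edge.
  indecomposableFromWalks : ∀ u v w {_ : True (walk? false (u ∷ v ∷ w))} →
                            ∀ u′ v′ w′ {_ : True (walk? true (u′ ∷ v′ ∷ w′))} → Indecomposable R
  indecomposableFromWalks u v w {walk} u′ v′ w′ {walk′} = record
    { constant = λ { false → constant false (toWitness walk) ; true → constant true (toWitness walk′) }
    ; tied     = λ { false → first false (toWitness walk) ; true → first true (toWitness walk′) }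
    }
    where
    constant : ∀ b {w} → Walk b w → Constant R b
    constant b (linked , covers) = walk⇒constant b _ linked covers
    first : ∀ b {u v w} → Walk b (u ∷ v ∷ w) → ∃₂ (Tied b R)
    first _ (inj₁ t ∷ _ , _) = _ , _ , t
    first _ (inj₂ t ∷ _ , _) = _ , _ , t

-- An element above an antichain of three, and a second element above exactly one (`R₁`) or exactly
-- two (`R₂`) of these three.
R₁ R₂ : NLPoset 5
R₁ = fromTable ([] ∷ [] ∷ [] ∷ (2 ∷ []) ∷ (0 ∷ 1 ∷ 2 ∷ []) ∷ [])
R₂ = fromTable ([] ∷ [] ∷ [] ∷ (1 ∷ 2 ∷ []) ∷ (0 ∷ 1 ∷ 2 ∷ []) ∷ [])

R₁-indecomposable : Indecomposable R₁
R₁-indecomposable = indecomposableFromWalks R₁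
  3F 2F (4F ∷ 0F ∷ 4F ∷ 1F ∷ []) 4F 3F (0F ∷ 1F ∷ 2F ∷ [])

R₂-indecomposable : Indecomposable R₂
R₂-indecomposable = indecomposableFromWalks R₂
  3F 2F (4F ∷ 0F ∷ 4F ∷ 1F ∷ []) 4F 3F (0F ∷ 1F ∷ 2F ∷ [])

-- Every element after the first is comparable to an earlier one, in `R₁` and in `R₂`, which prunes
-- the search early.
searchOrder : List (Fin 5)
searchOrder = 4F ∷ 2F ∷ 3F ∷ 0F ∷ 1F ∷ []

pair331 : EquivalentPair (3 ∷ 3 ∷ 1 ∷ [])
pair331 = record
  -- P and Q differ only at 4, which covers 1 in P and 0 in Q. Adjoining 0 ≤ 4 to P or 1 ≤ 4 to Q
  -- puts it above both; the reverse comparisons put it between 0 and 1, in mirror-image ways that ρ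
  -- matches.
  { P⇝Q            = exchange-injection {ρ = ρ} (from-yes (exchange? P Q 0F 4F 1F 4F ρ))
  ; Q⇝P            = exchange-injection {ρ = flip ρ} (from-yes (exchange? Q P 1F 4F 0F 4F (flip ρ)))
  -- Columns need not increase along a row: the chain 1 < 3 < 6 occupies columns 1, 0, 2.
  ; fillingP       = fillingFromTable P _ (0F ∷ 1F ∷ 0F ∷ 1F ∷ 2F ∷ 0F ∷ 1F ∷ []) (0 ∷ 1 ∷ 1 ∷ 0 ∷ 0 ∷ 2 ∷ 2 ∷ [])
  ; fillingQ       = fillingFromTable Q _ (0F ∷ 1F ∷ 0F ∷ 1F ∷ 2F ∷ 0F ∷ 1F ∷ []) (1 ∷ 0 ∷ 0 ∷ 1 ∷ 0 ∷ 2 ∷ 2 ∷ [])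
  ; indecomposable = R₁-indecomposable
  ; inP            = embeddingFromTable R₁ P (3F ∷ 4F ∷ 0F ∷ 5F ∷ 6F ∷ [])
  -- In Q no element has a three-element antichain below it, while in P the antichain 0, 3, 4 lies
  -- below 6.
  ; notInQ         = avoids⇒¬embedding {R = R₁} {P = Q} searchOrder (from-yes (avoids? R₁ Q searchOrder []))
  }
  where
  P Q : NLPoset 7
  P = fromTable ([] ∷ [] ∷ (0 ∷ []) ∷ (1 ∷ []) ∷ (1 ∷ []) ∷ (0 ∷ 1 ∷ 2 ∷ []) ∷ (0 ∷ 1 ∷ 3 ∷ 4 ∷ []) ∷ [])
  Q = fromTable ([] ∷ [] ∷ (0 ∷ []) ∷ (1 ∷ []) ∷ (0 ∷ []) ∷ (0 ∷ 1 ∷ 2 ∷ []) ∷ (0 ∷ 1 ∷ 3 ∷ 4 ∷ []) ∷ [])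
  ρ : Permutation′ 7
  ρ = permutationFromTable (1F ∷ 0F ∷ 3F ∷ 2F ∷ 4F ∷ 6F ∷ 5F ∷ []) (1F ∷ 0F ∷ 3F ∷ 2F ∷ 4F ∷ 6F ∷ 5F ∷ [])

pair332 : EquivalentPair (3 ∷ 3 ∷ 2 ∷ [])
pair332 = record
  -- This is the pair for (3,3,1) with a new element 5 on top of 4 and the former 5 and 6
  -- renumbered, so the same exchange applies.
  { P⇝Q            = exchange-injection {ρ = ρ} (from-yes (exchange? P Q 0F 4F 1F 4F ρ))
  ; Q⇝P            = exchange-injection {ρ = flip ρ} (from-yes (exchange? Q P 1F 4F 0F 4F (flip ρ)))
  ; fillingP       = fillingFromTable P _ (0F ∷ 1F ∷ 0F ∷ 1F ∷ 2F ∷ 2F ∷ 0F ∷ 1F ∷ []) (0 ∷ 2 ∷ 2 ∷ 0 ∷ 0 ∷ 1 ∷ 1 ∷ 1 ∷ [])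
  ; fillingQ       = fillingFromTable Q _ (0F ∷ 1F ∷ 0F ∷ 1F ∷ 2F ∷ 2F ∷ 0F ∷ 1F ∷ []) (2 ∷ 0 ∷ 0 ∷ 2 ∷ 0 ∷ 1 ∷ 1 ∷ 1 ∷ [])
  ; indecomposable = R₁-indecomposable
  ; inP            = embeddingFromTable R₁ P (3F ∷ 4F ∷ 0F ∷ 6F ∷ 7F ∷ [])
  ; notInQ         = avoids⇒¬embedding {R = R₁} {P = Q} searchOrder (from-yes (avoids? R₁ Q searchOrder []))
  }
  where
  P Q : NLPoset 8
  P = fromTable ([] ∷ [] ∷ (0 ∷ []) ∷ (1 ∷ []) ∷ (1 ∷ []) ∷ (1 ∷ 4 ∷ []) ∷ (0 ∷ 1 ∷ 2 ∷ []) ∷ (0 ∷ 1 ∷ 3 ∷ 4 ∷ []) ∷ [])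
  Q = fromTable ([] ∷ [] ∷ (0 ∷ []) ∷ (1 ∷ []) ∷ (0 ∷ []) ∷ (0 ∷ 4 ∷ []) ∷ (0 ∷ 1 ∷ 2 ∷ []) ∷ (0 ∷ 1 ∷ 3 ∷ 4 ∷ []) ∷ [])
  ρ : Permutation′ 8
  ρ = permutationFromTable (1F ∷ 0F ∷ 3F ∷ 2F ∷ 4F ∷ 5F ∷ 7F ∷ 6F ∷ []) (1F ∷ 0F ∷ 3F ∷ 2F ∷ 4F ∷ 5F ∷ 7F ∷ 6F ∷ [])

pair333 : EquivalentPair (3 ∷ 3 ∷ 3 ∷ [])
pair333 = record
  -- The moving element is now 5, and 2 is a third minimal element, below every element that is not
  -- minimal.
  { P⇝Q            = exchange-injection {ρ = ρ} (from-yes (exchange? P Q 0F 5F 1F 5F ρ))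
  ; Q⇝P            = exchange-injection {ρ = flip ρ} (from-yes (exchange? Q P 1F 5F 0F 5F (flip ρ)))
  ; fillingP       = fillingFromTable P _ (0F ∷ 1F ∷ 2F ∷ 0F ∷ 1F ∷ 2F ∷ 0F ∷ 2F ∷ 1F ∷ []) (0 ∷ 0 ∷ 0 ∷ 1 ∷ 1 ∷ 1 ∷ 2 ∷ 2 ∷ 2 ∷ [])
  ; fillingQ       = fillingFromTable Q _ (0F ∷ 1F ∷ 2F ∷ 0F ∷ 1F ∷ 2F ∷ 0F ∷ 2F ∷ 1F ∷ []) (0 ∷ 0 ∷ 0 ∷ 1 ∷ 1 ∷ 1 ∷ 2 ∷ 2 ∷ 2 ∷ [])
  ; indecomposable = R₁-indecomposable
  ; inP            = embeddingFromTable R₁ P (4F ∷ 5F ∷ 0F ∷ 6F ∷ 8F ∷ [])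
  -- In Q the only three-element antichain with an upper bound is 0, 1, 2, and every other element
  -- lies above at least two of these.
  ; notInQ         = avoids⇒¬embedding {R = R₁} {P = Q} searchOrder (from-yes (avoids? R₁ Q searchOrder []))
  }
  where
  P Q : NLPoset 9
  P = fromTable ([] ∷ [] ∷ [] ∷ (0 ∷ 2 ∷ []) ∷ (1 ∷ 2 ∷ []) ∷ (1 ∷ 2 ∷ []) ∷ (0 ∷ 1 ∷ 2 ∷ 3 ∷ []) ∷ (0 ∷ 1 ∷ 2 ∷ 5 ∷ []) ∷ (0 ∷ 1 ∷ 2 ∷ 4 ∷ 5 ∷ []) ∷ [])
  Q = fromTable ([] ∷ [] ∷ [] ∷ (0 ∷ 2 ∷ []) ∷ (1 ∷ 2 ∷ []) ∷ (0 ∷ 2 ∷ []) ∷ (0 ∷ 1 ∷ 2 ∷ 3 ∷ []) ∷ (0 ∷ 1 ∷ 2 ∷ 5 ∷ []) ∷ (0 ∷ 1 ∷ 2 ∷ 4 ∷ 5 ∷ []) ∷ [])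
  ρ : Permutation′ 9
  ρ = permutationFromTable (1F ∷ 0F ∷ 2F ∷ 4F ∷ 3F ∷ 5F ∷ 8F ∷ 7F ∷ 6F ∷ []) (1F ∷ 0F ∷ 2F ∷ 4F ∷ 3F ∷ 5F ∷ 8F ∷ 7F ∷ 6F ∷ [])

pair2222 : EquivalentPair (2 ∷ 2 ∷ 2 ∷ 2 ∷ [])
pair2222 = record
  -- Both posets receive the same comparison. With 2 ≤ 3, element 5 of P and element 6 of Q gain 2
  -- below them and the orders coincide; with 3 ≤ 2, element 4 gains 3 in both and ρ is the
  -- isomorphism.
  { P⇝Q            = exchange-injection {ρ = ρ} (from-yes (exchange? P Q 2F 3F 2F 3F ρ))
  ; Q⇝P            = exchange-injection {ρ = flip ρ} (from-yes (exchange? Q P 2F 3F 2F 3F (flip ρ)))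
  ; fillingP       = fillingFromTable P _ (0F ∷ 1F ∷ 2F ∷ 3F ∷ 0F ∷ 1F ∷ 2F ∷ 3F ∷ []) (0 ∷ 0 ∷ 0 ∷ 0 ∷ 1 ∷ 1 ∷ 1 ∷ 1 ∷ [])
  ; fillingQ       = fillingFromTable Q _ (0F ∷ 1F ∷ 2F ∷ 3F ∷ 0F ∷ 1F ∷ 3F ∷ 2F ∷ []) (0 ∷ 0 ∷ 0 ∷ 0 ∷ 1 ∷ 1 ∷ 1 ∷ 1 ∷ [])
  ; indecomposable = R₂-indecomposable
  ; inP            = embeddingFromTable R₂ P (1F ∷ 2F ∷ 3F ∷ 6F ∷ 7F ∷ [])
  -- In Q the elements 5 and 7 lie above the same three minimal elements, and 4 and 6 each lie above
  -- only one of those.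
  ; notInQ         = avoids⇒¬embedding {R = R₂} {P = Q} searchOrder (from-yes (avoids? R₂ Q searchOrder []))
  }
  where
  P Q : NLPoset 8
  P = fromTable ([] ∷ [] ∷ [] ∷ [] ∷ (0 ∷ 2 ∷ []) ∷ (1 ∷ 3 ∷ []) ∷ (0 ∷ 2 ∷ 3 ∷ []) ∷ (1 ∷ 2 ∷ 3 ∷ []) ∷ [])
  Q = fromTable ([] ∷ [] ∷ [] ∷ [] ∷ (0 ∷ 2 ∷ []) ∷ (1 ∷ 2 ∷ 3 ∷ []) ∷ (0 ∷ 3 ∷ []) ∷ (1 ∷ 2 ∷ 3 ∷ []) ∷ [])
  ρ : Permutation′ 8
  ρ = permutationFromTable (1F ∷ 0F ∷ 2F ∷ 3F ∷ 7F ∷ 4F ∷ 5F ∷ 6F ∷ []) (1F ∷ 0F ∷ 2F ∷ 3F ∷ 5F ∷ 6F ∷ 7F ∷ 4F ∷ [])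

-- Reaching every shape

addColumns : ∀ t {d} {xs : Vec ℕ m} {ys : Vec ℕ k} →
  VecAll.All (d ≤_) xs → VecAll.All (_≤ d) ys → EquivalentPair (xs ++ ys) → EquivalentPair (Vec.map (t +_) xs ++ ys)
addColumns zero    {xs = xs} {ys} d≤xs ys≤d pair = subst (λ v → EquivalentPair (v ++ ys)) (≡.sym (map-id xs)) pair
addColumns (suc t) {xs = xs} {ys} d≤xs ys≤d pair =
  subst (λ v → EquivalentPair (v ++ ys)) (≡.sym (map-∘ suc (t +_) xs))
    -- The rows of `xs` only get longer, so the same d serves for each further column.
    (addColumn (VecAll.map⁺ (VecAll.map (λ d≤x → ≤-trans d≤x (m≤n+m _ t)) d≤xs)) ys≤d
      (addColumns t d≤xs ys≤d pair))

addRows : ∀ {la : Vec ℕ k} (mu : List ℕ) → EquivalentPair la → EquivalentPair (Vec.fromList mu ++ la)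
addRows []       pair = pair
addRows (m ∷ mu) pair = addRow m (addRows mu pair)

module _ {a b c : ℕ} (b≤a : b ≤ a) (c≤b : c ≤ b) where

  stretch₃ : ∀ {e} → c ≤ e → e ≤ b → EquivalentPair (e ∷ e ∷ c ∷ []) → EquivalentPair (a ∷ b ∷ c ∷ [])
  stretch₃ {e} c≤e e≤b pair =
    subst (λ x → EquivalentPair (x ∷ b ∷ c ∷ [])) (m∸n+n≡m b≤a)
      (addColumns (a ∸ b) {xs = b ∷ []} (≤-refl ∷ []) (≤-refl ∷ c≤b ∷ [])
        (subst (λ x → EquivalentPair (x ∷ x ∷ c ∷ [])) (m∸n+n≡m e≤b)
          (addColumns (b ∸ e) {xs = e ∷ e ∷ []} (c≤e ∷ c≤e ∷ []) (≤-refl ∷ []) pair)))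

  -- Columns are added in order of decreasing height, from four down to one, so the extended rows
  -- are never shorter than the others.
  pair₄ : ∀ {d} → d ≤ c → 2 ≤ d → EquivalentPair (a ∷ b ∷ c ∷ d ∷ [])
  pair₄ {d} d≤c 2≤d =
    subst (λ x → EquivalentPair (x ∷ b ∷ c ∷ d ∷ [])) (m∸n+n≡m b≤a)
      (addColumns (a ∸ b) {xs = b ∷ []} (≤-refl ∷ []) (≤-refl ∷ c≤b ∷ ≤-trans d≤c c≤b ∷ [])
      (subst (λ x → EquivalentPair (x ∷ x ∷ c ∷ d ∷ [])) (m∸n+n≡m c≤b)
        (addColumns (b ∸ c) {xs = c ∷ c ∷ []} (≤-refl ∷ ≤-refl ∷ []) (≤-refl ∷ d≤c ∷ [])
        (subst (λ x → EquivalentPair (x ∷ x ∷ x ∷ d ∷ [])) (m∸n+n≡m d≤c)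
          (addColumns (c ∸ d) {xs = d ∷ d ∷ d ∷ []} (≤-refl ∷ ≤-refl ∷ ≤-refl ∷ []) (≤-refl ∷ [])
          (subst (λ x → EquivalentPair (x ∷ x ∷ x ∷ x ∷ [])) (m∸n+n≡m 2≤d)
            (addColumns (d ∸ 2) {ys = []} (z≤n ∷ z≤n ∷ z≤n ∷ z≤n ∷ []) [] pair2222)))))))

pair₃ : ∀ {a b c} → b ≤ a → c ≤ b → 3 ≤ b → 1 ≤ c → EquivalentPair (a ∷ b ∷ c ∷ [])
pair₃ {c = 1} b≤a c≤b 3≤b _ = stretch₃ b≤a c≤b (s≤s z≤n) 3≤b pair331
pair₃ {c = 2} b≤a c≤b 3≤b _ = stretch₃ b≤a c≤b (s≤s (s≤s z≤n)) 3≤b pair332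
pair₃ {c = suc (suc (suc c))} b≤a c≤b _ _ = stretch₃ b≤a c≤b ≤-refl c≤b
  (subst (λ x → EquivalentPair (x ∷ x ∷ x ∷ [])) (+-comm c 3)
    (addColumns c {ys = []} (z≤n ∷ z≤n ∷ z≤n ∷ []) [] pair333))

pair⇒theorem : ∀ {la : Vec ℕ k} mu → EquivalentPair la →
  Σ ℕ λ n → Σ ℕ λ m → Σ (NLPoset n) λ P → Σ (NLPoset m) λ Q →
    ¬ Iso P Q × HasShape P (toList la L.++ mu) × HasShape Q (toList la L.++ mu) × SameK P Q
pair⇒theorem {la = la} mu pair = _ , _ , P , Q ,
  (λ { (f , _ , _ , _ , iso) → notInQ (f ∘ proj₁ inP , λ x y →
         (λ p → proj₁ (iso _ _) (proj₁ (proj₂ inP x y) p)) ,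
         (λ p → proj₂ (proj₂ inP x y) (proj₂ (iso _ _) p))) }) ,
  shape fillingP , shape fillingQ , sameK P⇝Q Q⇝P
  where
  open EquivalentPair (addRows mu pair)
  rearranged : toList (Vec.fromList mu ++ la) ↭ toList la L.++ mu
  rearranged = subst (_↭ toList la L.++ mu)
    (≡.sym (≡.trans (toList-++ (Vec.fromList mu) la) (cong (L._++ toList la) (toList∘fromList mu))))
    (++-comm mu (toList la))
  shape : ∀ {R : NLPoset size} → Filling R (Vec.fromList mu ++ la) → HasShape R (toList la L.++ mu)
  shape {R} filling i = subst (MaxUnionAntichains R i) (conjSum-↭ rearranged i) (filling⇒shape filling i)

theorem5p5 : (la : List ℕ) → IsPartition la →
    (la ⊇ʸ (3 ∷ 3 ∷ 1 ∷ []) ⊎ la ⊇ʸ (2 ∷ 2 ∷ 2 ∷ 2 ∷ [])) →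
    Σ ℕ λ n → Σ ℕ λ m → Σ (NLPoset n) λ P → Σ (NLPoset m) λ Q →
    ¬ Iso P Q × HasShape P la × HasShape Q la × SameK P Q
theorem5p5 (a ∷ b ∷ c ∷ mu) (b≤a ∷ c≤b ∷ _ , _) (inj₁ la⊇) =
  -- Parts are indexed from 0: these two instances are 3 ≤ b and 1 ≤ c.
  pair⇒theorem mu (pair₃ b≤a c≤b (la⊇ 1) (la⊇ 2))
theorem5p5 (a ∷ b ∷ c ∷ d ∷ mu) (b≤a ∷ c≤b ∷ d≤c ∷ _ , _) (inj₂ la⊇) =
  pair⇒theorem mu (pair₄ b≤a c≤b d≤c (la⊇ 3))
theorem5p5 []               _ (inj₁ la⊇) = contradiction (la⊇ 0) λ ()
theorem5p5 (_ ∷ [])         _ (inj₁ la⊇) = contradiction (la⊇ 1) λ ()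
theorem5p5 (_ ∷ _ ∷ [])     _ (inj₁ la⊇) = contradiction (la⊇ 2) λ ()
theorem5p5 []               _ (inj₂ la⊇) = contradiction (la⊇ 0) λ ()
theorem5p5 (_ ∷ [])         _ (inj₂ la⊇) = contradiction (la⊇ 1) λ ()
theorem5p5 (_ ∷ _ ∷ [])     _ (inj₂ la⊇) = contradiction (la⊇ 2) λ ()
theorem5p5 (_ ∷ _ ∷ _ ∷ []) _ (inj₂ la⊇) = contradiction (la⊇ 3) λ ()
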